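{- (i) If $f$ is a balanced domination function (BDF) on a full binary tree $T$ with root vertex $r$, then $f(r)=0$. (ii) Every full binary tree is $d$-balanced.
   Context: For a simple undirected finite graph $G$ and $v\in V(G)$, the closed neighborhood is $N_G[v]=\{u\in V(G): uv\in E(G)\}\cup\{v\}$. A function $f\colon V(G)\to\{ -1,0,1\}$ is a balanced domination function (BDF) on $G$ if $\sum_{u\in N_G[v]} f(u)=0$ for every $v\in V(G)$. Its weight is $\omega_f=\sum_{v\in V(G)} f(v)$. The balanced domination number $\gamma_{bd}(G)$ is the maximum of $\omega_f$ over all BDFs $f$ on $G$. The graph $G$ is called $d$-balanced if $\gamma_{bd}(G)=0$. A (finite) rooted tree is a binary tree if every vertex has at most two children. A binary tree is a full binary tree if each of its vertices has exactly $0$ or $2$ children. -}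

module Defs where

open import Level using (0ℓ)
open import Data.Nat.Base as ℕ using (ℕ)
open import Data.Integer.Base as ℤ using (ℤ; 0ℤ; 1ℤ; -1ℤ)
open import Data.Fin.Base using (Fin)
open import Data.Fin.Properties using (_≟_)
open import Data.List.Base using (List; []; _∷_; [_]; map; foldr; filter; allFin; length)
open import Data.List.Membership.Propositional using (_∈_)
open import Data.List.Relation.Unary.Unique.Propositional using (Unique)
open import Data.Product.Base using (_×_; ∃-syntax)
open import Data.Sum.Base using (_⊎_)
open import Function.Bundles using (_⇔_)
open import Relation.Binary.Core using (Rel)
open import Relation.Binary.Definitions using (Decidable; Symmetric; Irreflexive)
open import Relation.Binary.PropositionalEquality.Core using (_≡_)
open import Relation.Nullary.Decidable using (_⊎-dec_)
open import Relation.Nullary.Negation using (¬_)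

record Graph (n : ℕ) : Set₁ where
  field
    Adj    : Rel (Fin n) 0ℓ
    adj?   : Decidable Adj
    sym    : Symmetric Adj
    irrefl : Irreflexive _≡_ Adj

∑ : {n : ℕ} → List (Fin n) → (Fin n → ℤ) → ℤ
∑ us f = foldr ℤ._+_ 0ℤ (map f us)

weight : {n : ℕ} → (Fin n → ℤ) → ℤ
weight {n} f = ∑ (allFin n) f

module _ {n : ℕ} (G : Graph n) where
  open Graph G

  N[_] : Fin n → List (Fin n)
  N[ v ] = filter (λ u → adj? u v ⊎-dec u ≟ v) (allFin n)

  record IsBDF (f : Fin n → ℤ) : Set where
    field
      range    : ∀ v → f v ≡ -1ℤ ⊎ f v ≡ 0ℤ ⊎ f v ≡ 1ℤ
      balanced : ∀ v → ∑ N[ v ] f ≡ 0ℤ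

  -- "γ_bd(G) = k": the maximum is given as a relation, namely k is attained
  -- and is an upper bound.
  record BalancedDominationNumber (k : ℤ) : Set where
    field
      attained : ∃[ f ] IsBDF f × weight f ≡ k
      maximal  : ∀ f → IsBDF f → weight f ℤ.≤ k

  DBalanced : Set
  DBalanced = BalancedDominationNumber 0ℤ

  infixr 5 _∷_

  data Walk : Fin n → Fin n → Set where
    []  : ∀ {v} → Walk v v
    _∷_ : ∀ {u v w} → Adj u v → Walk v w → Walk u w

  vertices : ∀ {u v} → Walk u v → List (Fin n)
  vertices {u} []      = [ u ]
  vertices {u} (_ ∷ p) = u ∷ vertices p

  IsPath : ∀ {u v} → Walk u v → Set
  IsPath p = Unique (vertices p)

  Connected : Set
  Connected = ∀ u v → Walk u v

  -- A cycle is a path on at least three vertices together with an edge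
  -- joining its two ends.
  record Cycle : Set where
    field
      {start end} : Fin n
      path        : Walk start end
      isPath      : IsPath path
      long        : 3 ℕ.≤ length (vertices path)
      closing     : Adj end start

  record IsTree : Set where
    field
      connected : Connected
      acyclic   : ¬ Cycle

  module _ (r : Fin n) where

    -- v is the vertex following u on the path from u to the root r.
    IsChild : (u v : Fin n) → Set
    IsChild u v = ∃[ e ] ∃[ p ] IsPath {u} {r} (_∷_ {v = v} e p)

    HasChildren : Fin n → ℕ → Set
    HasChildren v k =
      ∃[ us ] Unique us × (∀ u → u ∈ us ⇔ IsChild u v) × length us ≡ k

    record IsBinaryTree : Set where
      field
        isTree : IsTree
        binary : ∀ v → ∃[ k ] k ℕ.≤ 2 × HasChildren v k

    record IsFullBinaryTree : Set where
      field
        isBinaryTree : IsBinaryTree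
        full         : ∀ v → HasChildren v 0 ⊎ HasChildren v 2

{-# OPTIONS --safe #-}
-- A balanced domination function f on a full binary tree vanishes identically.
-- Working up from the leaves, f v and f (parent v) have the same parity: a leaf
-- gives f v + f p = 0, and if both children of v agree with v modulo 2 they cancel
-- in the closed neighbourhood sum of v, leaving f v + f p even.  At the root the
-- same cancellation leaves f r even; since the tree is connected every value of
-- f is then even, hence 0.
module Submission where

open import Defs
open import Data.Nat.Base as ℕ using (ℕ; zero; suc; s≤s; z≤n)
import Data.Nat.Properties as ℕ
open import Data.Integer.Base using (ℤ; +_; 0ℤ; 1ℤ; -1ℤ; _+_; _-_; _*_)
import Data.Integer.Properties as ℤ
open import Data.Integer.Divisibility.Signed
  using (_∣_; divides; _∣?_; ∣m∣n⇒∣m+n; ∣m∣n⇒∣m-n; ∣m+n∣m⇒∣n)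
open import Data.Integer.Tactic.RingSolver using (solve-∀)
open import Data.Fin.Base using (Fin; zero; suc)
open import Data.Fin.Properties using (_≟_; injective⇒≤)
open import Data.List.Base using (List; []; _∷_; allFin; length; lookup)
open import Data.List.Membership.Propositional using (_∈_; _∉_)
open import Data.List.Membership.Propositional.Properties
  using (∈-filter⁺; ∈-filter⁻; ∈-allFin; ∈-lookup)
open import Data.List.Membership.Propositional.Properties.WithK using (unique∧set⇒bag)
open import Data.List.Relation.Binary.BagAndSetEquality using (_∼[_]_; set; ∼bag⇒↭)
open import Data.List.Relation.Binary.Permutation.Propositional using (_↭_; ↭⇒↭ₛ)
open import Data.List.Relation.Binary.Permutation.Propositional.Properties using (map⁺)
import Data.List.Relation.Binary.Permutation.Setoid.Properties as Permutation
open import Data.List.Relation.Unary.All as All using (All; []; _∷_)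
open import Data.List.Relation.Unary.All.Properties using (All¬⇒¬Any; ¬Any⇒All¬)
open import Data.List.Relation.Unary.AllPairs using ([]; _∷_)
open import Data.List.Relation.Unary.Any using (here; there)
open import Data.List.Relation.Unary.Unique.Propositional using (Unique)
open import Data.List.Relation.Unary.Unique.Propositional.Properties
  using (filter⁺; allFin⁺)
open import Data.Product.Base using (_×_; _,_; ∃-syntax; proj₁; proj₂)
open import Data.Sum.Base using (_⊎_; inj₁; inj₂; [_,_]′)
open import Function.Base using (_∘_)
open import Function.Bundles using (_⇔_; mk⇔; module Equivalence)
open import Relation.Binary.PropositionalEquality.Core
  using (_≡_; _≢_; refl; sym; trans; cong; subst)
open import Relation.Binary.PropositionalEquality.Properties using (setoid)
open import Relation.Nullary.Decidable using (yes; no; from-no; _⊎-dec_)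
open import Relation.Nullary.Negation using (¬_; contradiction)

-- Congruence modulo 2.

-- Modulo 2 a sum and a difference agree; the sum is used because the neighbourhood equations
-- produce terms of the form `f v + f p` directly.
SameParity : ℤ → ℤ → Set
SameParity x y = + 2 ∣ x + y

sameParity-refl : ∀ x → SameParity x x
sameParity-refl x = divides x (lemma x)
  where
  lemma : ∀ x → x + x ≡ x * + 2
  lemma = solve-∀

sameParity-sym : ∀ x y → SameParity x y → SameParity y x
sameParity-sym x y = subst (+ 2 ∣_) (ℤ.+-comm x y)

sameParity-trans : ∀ x y z → SameParity x y → SameParity y z → SameParity x z
sameParity-trans x y z x~y y~z =
  subst (+ 2 ∣_) (lemma x y z) (∣m∣n⇒∣m-n (∣m∣n⇒∣m+n x~y y~z) (sameParity-refl y))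
  where
  lemma : ∀ x y z → (x + y) + (y + z) - (y + y) ≡ x + z
  lemma = solve-∀

even∧unit⇒0 : ∀ {x} → x ≡ -1ℤ ⊎ x ≡ 0ℤ ⊎ x ≡ 1ℤ → + 2 ∣ x → x ≡ 0ℤ
even∧unit⇒0 (inj₁ refl)        2∣x = contradiction 2∣x (from-no (+ 2 ∣? -1ℤ))
even∧unit⇒0 (inj₂ (inj₁ refl)) _   = refl
even∧unit⇒0 (inj₂ (inj₂ refl)) 2∣x = contradiction 2∣x (from-no (+ 2 ∣? 1ℤ))

-- Repetition-free lists and sums over them.

unique⇒lookup-injective : ∀ {A : Set} {xs : List A} → Unique xs →
                          ∀ {i j} → lookup xs i ≡ lookup xs j → i ≡ j
unique⇒lookup-injective (_ ∷ _)    {zero}  {zero}  _  = refl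
unique⇒lookup-injective (x∉ ∷ _)   {zero}  {suc j} eq =
  contradiction eq (All.lookup x∉ (∈-lookup j))
unique⇒lookup-injective (x∉ ∷ _)   {suc i} {zero}  eq =
  contradiction (sym eq) (All.lookup x∉ (∈-lookup i))
unique⇒lookup-injective (_ ∷ uniq) {suc i} {suc j} eq =
  cong suc (unique⇒lookup-injective uniq eq)

unique⇒length≤ : ∀ {n} {us : List (Fin n)} → Unique us → length us ℕ.≤ n
unique⇒length≤ uniq = injective⇒≤ (unique⇒lookup-injective uniq)

unique∧set⇒↭ : ∀ {A : Set} {xs ys : List A} → Unique xs → Unique ys →
               xs ∼[ set ] ys → xs ↭ ys
unique∧set⇒↭ xs! ys! xs∼ys = ∼bag⇒↭ (unique∧set⇒bag xs! ys! xs∼ys)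

∑-↭ : ∀ {n} {us vs : List (Fin n)} (f : Fin n → ℤ) → us ↭ vs → ∑ us f ≡ ∑ vs f
∑-↭ f us↭vs = Permutation.foldr-commMonoid (setoid ℤ)
  ℤ.+-0-isCommutativeMonoid (↭⇒↭ₛ (map⁺ f us↭vs))

∑-zero : ∀ {n} (us : List (Fin n)) {f : Fin n → ℤ} → (∀ v → f v ≡ 0ℤ) → ∑ us f ≡ 0ℤ
∑-zero []       _   = refl
∑-zero (u ∷ us) f≡0 rewrite f≡0 u = trans (ℤ.+-identityˡ _) (∑-zero us f≡0)

∉⇒All≢ : ∀ {n} {v : Fin n} {us} → v ∉ us → All (v ≢_) us
∉⇒All≢ = ¬Any⇒All¬ _

module _ {n : ℕ} (G : Graph n) where
  open Graph G renaming (sym to adj-sym)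
  open import Data.List.Membership.DecPropositional (_≟_ {n}) using (_∈?_)

  -- Walks and the paths inside them.

  head∈ : ∀ {u v} (p : Walk G u v) → u ∈ vertices G p
  head∈ []      = here refl
  head∈ (_ ∷ _) = here refl

  last∈ : ∀ {u v} (p : Walk G u v) → v ∈ vertices G p
  last∈ []      = here refl
  last∈ (_ ∷ p) = there (last∈ p)

  infixr 5 _ʳ++_

  _ʳ++_ : ∀ {u v w} → Walk G u v → Walk G u w → Walk G v w
  []      ʳ++ q = q
  (e ∷ p) ʳ++ q = p ʳ++ (adj-sym e ∷ q)

  ∈-ʳ++⁻ : ∀ {u v w x} (p : Walk G u v) (q : Walk G u w) →
           x ∈ vertices G (p ʳ++ q) → x ∈ vertices G p ⊎ x ∈ vertices G q
  ∈-ʳ++⁻ []      q x∈ = inj₂ x∈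
  ∈-ʳ++⁻ (e ∷ p) q x∈ with ∈-ʳ++⁻ p (adj-sym e ∷ q) x∈
  ... | inj₁ x∈p         = inj₁ (there x∈p)
  ... | inj₂ (here refl) = inj₁ (there (head∈ p))
  ... | inj₂ (there x∈q) = inj₂ x∈q

  reverse : ∀ {u v} → Walk G u v → Walk G v u
  reverse p = p ʳ++ []

  ∈-reverse⁻ : ∀ {u v x} (p : Walk G u v) → x ∈ vertices G (reverse p) → x ∈ vertices G p
  ∈-reverse⁻ p x∈ with ∈-ʳ++⁻ p [] x∈
  ... | inj₁ x∈p         = x∈p
  ... | inj₂ (here refl) = head∈ p

  prefix : ∀ {u v w} (p : Walk G u v) → w ∈ vertices G p →
           ∃[ q ] (∀ {x} → x ∈ vertices G {u} {w} q → x ∈ vertices G p)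
  prefix []      (here refl) = [] , λ x∈ → x∈
  prefix (_ ∷ _) (here refl) = [] , λ { (here refl) → here refl }
  prefix (e ∷ p) (there w∈)  with prefix p w∈
  ... | q , q⊆p = e ∷ q , λ { (here refl) → here refl ; (there x∈) → there (q⊆p x∈) }

  suffix : ∀ {u v w} (p : Walk G u v) → w ∈ vertices G p → IsPath G p →
           ∃[ q ] IsPath G {w} {v} q × (∀ {x} → x ∈ vertices G q → x ∈ vertices G p)
  suffix []      (here refl) path       = [] , path , λ x∈ → x∈
  suffix (e ∷ p) (here refl) path       = e ∷ p , path , λ x∈ → x∈
  suffix (_ ∷ p) (there w∈)  (_ ∷ path) with suffix p w∈ path
  ... | q , path′ , q⊆p = q , path′ , there ∘ q⊆p

  -- Loop erasure: if the head recurs in the shortened tail, the tail is cut back to that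
  -- recurrence. The inclusion of vertices is recorded so that a vertex avoided by the walk is still
  -- avoided by the path.
  toPath : ∀ {u v} (p : Walk G u v) →
           ∃[ q ] IsPath G {u} {v} q × (∀ {x} → x ∈ vertices G q → x ∈ vertices G p)
  toPath []              = [] , [] ∷ [] , λ x∈ → x∈
  toPath {u} (e ∷ p) with toPath p
  ... | q , path , q⊆p with u ∈? vertices G q
  ...   | no u∉q  = e ∷ q , ∉⇒All≢ u∉q ∷ path ,
                    λ { (here refl) → here refl ; (there x∈) → there (q⊆p x∈) }
  ...   | yes u∈q with suffix q u∈q path
  ...     | q′ , path′ , q′⊆q = q′ , path′ , there ∘ q⊆p ∘ q′⊆q

  0<length-vertices : ∀ {u v} (p : Walk G u v) → 1 ℕ.≤ length (vertices G p)
  0<length-vertices []      = s≤s z≤n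
  0<length-vertices (_ ∷ _) = s≤s z≤n

  -- Parents and children in an acyclic graph.

  module _ (acyclic : ¬ Cycle G) where

    -- Otherwise loop erasure leaves a path with at least one edge from `u` to `w` that avoids `v`,
    -- and joining both of its ends to `v` closes a cycle.
    acyclic⇒neighbour-unique : ∀ {v u w} → Adj v u → Adj v w →
      (p : Walk G u w) → v ∉ vertices G p → u ≡ w
    acyclic⇒neighbour-unique v~u v~w p v∉p with toPath p
    ... | []    , _    , _   = refl
    ... | e ∷ q , path , q⊆p = contradiction cycle acyclic
      where
      cycle : Cycle G
      cycle = record
        { path    = v~u ∷ e ∷ q
        ; isPath  = ∉⇒All≢ (v∉p ∘ q⊆p) ∷ path
        ; long    = s≤s (s≤s (0<length-vertices q))
        ; closing = adj-sym v~w
        }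

    module _ (r : Fin n) where

      -- The paths from `u` and `w` to `r` both avoid `v`; glued at `r` they form a walk from `u` to
      -- `w` avoiding `v`.
      parent-unique : ∀ {v u w} → IsChild G r v u → IsChild G r v w → u ≡ w
      parent-unique (v~u , p , v∉p ∷ _) (v~w , q , v∉q ∷ _) =
        acyclic⇒neighbour-unique v~u v~w (reverse p ʳ++ reverse q)
          ([ All¬⇒¬Any v∉p ∘ ∈-reverse⁻ p , All¬⇒¬Any v∉q ∘ ∈-reverse⁻ q ]′
            ∘ ∈-ʳ++⁻ (reverse p) (reverse q))

      root-parentless : ∀ {v} → ¬ IsChild G r r v
      root-parentless (_ , p , r∉p ∷ _) = All¬⇒¬Any r∉p (last∈ p)

      -- Consider the path from `u` through `v` to `r`. If it stops at `v`, then `v` is the root and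
      -- has no parent. Otherwise its next vertex is the parent of `v`, hence equal to `u`, and `u`
      -- would be repeated.
      isChild-asym : ∀ {u v} → IsChild G r u v → ¬ IsChild G r v u
      isChild-asym (_ , []    , _)                 v<u = root-parentless v<u
      isChild-asym (_ , e ∷ p , (_ ∷ u∉p) ∷ path) v<u
        with refl ← parent-unique v<u (e , p , path) = All¬⇒¬Any u∉p (head∈ p)

      -- If `u` lies on `p`, it comes after `v`, and the part of `p` from the second vertex to `u`
      -- avoids `v`. By acyclicity the second vertex is `u` itself.
      adj⇒extends⊎isChild : ∀ {u v} → Adj u v → (p : Walk G v r) → IsPath G p →
                            u ∉ vertices G p ⊎ IsChild G r v u
      adj⇒extends⊎isChild {u} u~v p path with u ∈? vertices G p
      ... | no u∉p = inj₁ u∉p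
      adj⇒extends⊎isChild u~v []      _            | yes (here refl) =
        contradiction u~v (irrefl refl)
      adj⇒extends⊎isChild u~v (_ ∷ _) _            | yes (here refl) =
        contradiction u~v (irrefl refl)
      adj⇒extends⊎isChild u~v (e ∷ p) (v∉p ∷ path) | yes (there u∈p)
        with q , q⊆p ← prefix p u∈p
        with refl ← acyclic⇒neighbour-unique e (adj-sym u~v) q (All¬⇒¬Any v∉p ∘ q⊆p)
        = inj₂ (e , p , v∉p ∷ path)

      -- This lets the induction towards the leaves lengthen any path to the root by a child of its
      -- first vertex.
      child-extends : ∀ {c v} → IsChild G r c v → (p : Walk G v r) → IsPath G p →
                      c ∉ vertices G p
      child-extends c<v@(c~v , _) p path with adj⇒extends⊎isChild c~v p path
      ... | inj₁ c∉p = c∉p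
      ... | inj₂ v<c = contradiction v<c (isChild-asym c<v)

      adj⇒isChild : Connected G → ∀ {u v} → Adj u v → IsChild G r u v ⊎ IsChild G r v u
      adj⇒isChild connected {u} {v} u~v with toPath (connected v r)
      ... | p , path , _ with adj⇒extends⊎isChild u~v p path
      ...   | inj₁ u∉p = inj₁ (u~v , p , ∉⇒All≢ u∉p ∷ path)
      ...   | inj₂ v<u = inj₂ v<u

  -- Closed neighbourhoods listed by parent and children.

  ∈-N⁺ : ∀ {u v} → Adj u v ⊎ u ≡ v → u ∈ N[_] G v
  ∈-N⁺ {u} {v} = ∈-filter⁺ (λ u → adj? u v ⊎-dec u ≟ v) (∈-allFin u)

  ∈-N⁻ : ∀ {u v} → u ∈ N[_] G v → Adj u v ⊎ u ≡ v
  ∈-N⁻ {_} {v} u∈ = proj₂ (∈-filter⁻ (λ u → adj? u v ⊎-dec u ≟ v) {xs = allFin n} u∈)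

  N-unique : ∀ v → Unique (N[_] G v)
  N-unique v = filter⁺ (λ u → adj? u v ⊎-dec u ≟ v) (allFin⁺ n)

  module _ (r : Fin n) (isFull : IsFullBinaryTree G r) where
    open IsFullBinaryTree isFull
    open IsTree (IsBinaryTree.isTree isBinaryTree)

    self∉children : ∀ {v us} → (∀ u → u ∈ us ⇔ IsChild G r u v) → v ∉ us
    self∉children {v} children v∈us =
      irrefl refl (proj₁ (Equivalence.to (children v) v∈us))

    root-neighbourhood : ∀ {us} → Unique us → (∀ u → u ∈ us ⇔ IsChild G r u r) →
                         N[_] G r ↭ r ∷ us
    root-neighbourhood {us} uniq children =
      unique∧set⇒↭ (N-unique r) (∉⇒All≢ (self∉children children) ∷ uniq) (mk⇔ to from)
      where
      to : ∀ {u} → u ∈ N[_] G r → u ∈ r ∷ us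
      to {u} u∈N with ∈-N⁻ u∈N
      ... | inj₂ refl = here refl
      ... | inj₁ u~r with adj⇒isChild acyclic r connected u~r
      ...   | inj₁ u<r = there (Equivalence.from (children u) u<r)
      ...   | inj₂ r<u = contradiction r<u (root-parentless acyclic r)

      from : ∀ {u} → u ∈ r ∷ us → u ∈ N[_] G r
      from     (here u≡r)   = ∈-N⁺ (inj₂ u≡r)
      from {u} (there u∈us) = ∈-N⁺ (inj₁ (proj₁ (Equivalence.to (children u) u∈us)))

    -- Every edge at `v` leads to a child or to the unique parent, and asymmetry keeps the parent
    -- out of the list of children. Both lists are thus repetition-free with the same members.
    neighbourhood : ∀ {v p us} → IsChild G r v p →
                    Unique us → (∀ u → u ∈ us ⇔ IsChild G r u v) →
                    N[_] G v ↭ v ∷ p ∷ us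
    neighbourhood {v} {p} {us} v<p uniq children =
      unique∧set⇒↭ (N-unique v)
        ((v≢p ∷ ∉⇒All≢ (self∉children children)) ∷ ∉⇒All≢ p∉us ∷ uniq) (mk⇔ to from)
      where
      v≢p : v ≢ p
      v≢p v≡p = irrefl v≡p (proj₁ v<p)

      p∉us : p ∉ us
      p∉us p∈us = isChild-asym acyclic r v<p (Equivalence.to (children p) p∈us)

      to : ∀ {u} → u ∈ N[_] G v → u ∈ v ∷ p ∷ us
      to {u} u∈N with ∈-N⁻ u∈N
      ... | inj₂ refl = here refl
      ... | inj₁ u~v with adj⇒isChild acyclic r connected u~v
      ...   | inj₁ u<v = there (there (Equivalence.from (children u) u<v))
      ...   | inj₂ v<u = there (here (parent-unique acyclic r v<u v<p))

      from : ∀ {u} → u ∈ v ∷ p ∷ us → u ∈ N[_] G v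
      from     (here u≡v)           = ∈-N⁺ (inj₂ u≡v)
      from     (there (here refl))  = ∈-N⁺ (inj₁ (adj-sym (proj₁ v<p)))
      from {u} (there (there u∈us)) = ∈-N⁺ (inj₁ (proj₁ (Equivalence.to (children u) u∈us)))

    -- Parity along the edges of the tree.

    module _ {f : Fin n → ℤ} (bdf : IsBDF G f) where
      open IsBDF bdf

      -- A path has at most n vertices, so k bounds the height of the subtree at v.
      child-parity : ∀ k {v p} (e : Adj v p) (q : Walk G p r) → IsPath G (e ∷ q) →
                     n ℕ.< k ℕ.+ length (vertices G (e ∷ q)) → SameParity (f v) (f p)
      child-parity zero    e q path n< = contradiction (unique⇒length≤ path) (ℕ.<⇒≱ n<)
      child-parity (suc k) {v} {p} e q path n< with full v
      ... | inj₁ ([] , uniq , children , refl) =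
        divides 0ℤ (trans (lemma (f v) (f p))
          (trans (sym (∑-↭ f (neighbourhood (e , q , path) uniq children))) (balanced v)))
        where
        lemma : ∀ x y → x + y ≡ x + (y + 0ℤ)
        lemma = solve-∀
      ... | inj₂ (a ∷ b ∷ [] , uniq , children , refl) =
        -- Adding the even number `f v + f v` to the vanishing neighbourhood sum supplies one `f v`
        -- for each child, so the sum splits into two even child terms and `f v + f p`.
        ∣m+n∣m⇒∣n {m = (f a + f v) + (f b + f v)}
          (subst (+ 2 ∣_) (lemma (f v) (f p) (f a) (f b))
            (∣m∣n⇒∣m+n (subst (+ 2 ∣_) (sym sum≡0) (divides 0ℤ refl)) (sameParity-refl (f v))))
          (∣m∣n⇒∣m+n (parity (here refl)) (parity (there (here refl))))
        where
        lemma : ∀ x y a b → x + (y + (a + (b + 0ℤ))) + (x + x) ≡ ((a + x) + (b + x)) + (x + y)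
        lemma = solve-∀

        sum≡0 : ∑ (v ∷ p ∷ a ∷ b ∷ []) f ≡ 0ℤ
        sum≡0 = trans (sym (∑-↭ f (neighbourhood (e , q , path) uniq children))) (balanced v)

        parity : ∀ {c} → c ∈ a ∷ b ∷ [] → SameParity (f c) (f v)
        parity {c} c∈ = child-parity k (proj₁ c<v) (e ∷ q)
          (∉⇒All≢ (child-extends acyclic r c<v (e ∷ q) path) ∷ path)
          -- The bound drops by one while the path gains one vertex, so their total is unchanged.
          (subst (n ℕ.<_) (sym (ℕ.+-suc k _)) n<)
          where
          c<v : IsChild G r c v
          c<v = Equivalence.to (children c) c∈

      isChild⇒sameParity : ∀ {v p} → IsChild G r v p → SameParity (f v) (f p)
      isChild⇒sameParity (e , q , path) = child-parity (suc n) e q path (ℕ.m≤m+n (suc n) _)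

      root-even : + 2 ∣ f r
      root-even with full r
      ... | inj₁ ([] , uniq , children , refl) =
        divides 0ℤ (trans (sym (ℤ.+-identityʳ (f r)))
          (trans (sym (∑-↭ f (root-neighbourhood uniq children))) (balanced r)))
      ... | inj₂ (a ∷ b ∷ [] , uniq , children , refl) =
        -- The same regrouping as below the root, but with no parent term: what remains is `f r`
        -- alone.
        ∣m+n∣m⇒∣n {m = (f a + f r) + (f b + f r)}
          (subst (+ 2 ∣_) (lemma (f r) (f a) (f b))
            (∣m∣n⇒∣m+n (subst (+ 2 ∣_) (sym sum≡0) (divides 0ℤ refl)) (sameParity-refl (f r))))
          (∣m∣n⇒∣m+n (parity (here refl)) (parity (there (here refl))))
        where
        lemma : ∀ x a b → x + (a + (b + 0ℤ)) + (x + x) ≡ ((a + x) + (b + x)) + x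
        lemma = solve-∀

        sum≡0 : ∑ (r ∷ a ∷ b ∷ []) f ≡ 0ℤ
        sum≡0 = trans (sym (∑-↭ f (root-neighbourhood uniq children))) (balanced r)

        parity : ∀ {c} → c ∈ a ∷ b ∷ [] → SameParity (f c) (f r)
        parity {c} = isChild⇒sameParity ∘ Equivalence.to (children c)

      -- Evenness travels back from `r`. A walk may go up or down the tree, so both orientations of
      -- an edge occur.
      walk⇒even : ∀ {v} → Walk G v r → + 2 ∣ f v
      walk⇒even [] = root-even
      walk⇒even {v} (_∷_ {v = w} v~w p) =
        ∣m+n∣m⇒∣n {m = f w}
          ([ sameParity-sym (f v) (f w) ∘ isChild⇒sameParity , isChild⇒sameParity ]′
            (adj⇒isChild acyclic r connected v~w))
          (walk⇒even p)

      bdf-zero : ∀ v → f v ≡ 0ℤ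
      bdf-zero v = even∧unit⇒0 (range v) (walk⇒even (connected v r))

  zero-isBDF : IsBDF G (λ _ → 0ℤ)
  zero-isBDF = record
    { range    = λ _ → inj₂ (inj₁ refl)
    ; balanced = λ v → ∑-zero (N[_] G v) (λ _ → refl)
    }

theorem5 : (∀ {n : ℕ} (T : Graph n) (r : Fin n) → IsFullBinaryTree T r →
    ∀ (f : Fin n → ℤ) → IsBDF T f → f r ≡ 0ℤ)
    ×
    (∀ {n : ℕ} (T : Graph n) (r : Fin n) → IsFullBinaryTree T r → DBalanced T)
theorem5 =
  (λ T r isFull f bdf → bdf-zero T r isFull bdf r) ,
  (λ {n} T r isFull → record
    { attained = (λ _ → 0ℤ) , zero-isBDF T , ∑-zero (allFin n) (λ _ → refl)
    -- Any BDF vanishes identically, so its weight is exactly 0.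
    ; maximal  = λ f bdf → ℤ.≤-reflexive (∑-zero (allFin n) (bdf-zero T r isFull bdf))
    })
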